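{- Let $0<\varepsilon\le1$, $\alpha\ge1$ and $0<\beta<1$. Then the competitive ratio (with respect to throughput, on instances with $\varepsilon$-slack) of the region algorithm with parameters $\alpha,\beta$ is bounded from below by $\alpha/\beta$.
   Context: Setting. Jobs arrive online over time on a single machine. Job $j$ has release date $r_j$, processing time $p_j\ge 0$ and deadline $d_j$; it becomes known to an online algorithm at time $r_j$. To complete on time, $j$ must receive a total of $p_j$ units of processing within $[r_j,d_j]$; preemption is allowed. An instance is a finite set of jobs; it has $\varepsilon$-slack if $d_j-r_j\ge(1+\varepsilon)p_j$ for every job $j$. The throughput is the number of jobs completed on time. An online algorithm is $c$-competitive if for every instance with $\varepsilon$-slack the throughput of an optimal offline schedule is at most $c$ times the algorithm's throughput; its competitive ratio is the infimum of such $c$. Region algorithm with parameters $\alpha\ge1$, $0<\beta<1$, and a constant $\delta$ with $0<\delta<\varepsilon$. Each admitted job $j$ owns a region $R(j)$, a finite union of half-open intervals of total length $\alpha p_j$; regions of distinct jobs are disjoint. A machine job $M$ with $p_M=\infty$ is added; its region consists of all times in no other region. A job $i$ is available at time $t$ if $r_i\le t$, $i$ has not yet been admitted, and $d_i-t\ge(1+\delta)p_i$. Whenever, at some time $t$, a job is released or a region ends, the region preemption routine is called: let $k$ be the job (possibly $M$) whose region contains $t$ and let $i$ be a shortest available job at $t$ (if one exists). If $p_i<\beta p_k$, then $i$ is admitted at time $t$ and gets the region $R(i)=[t,t+\alpha p_i)$, and all parts in $[t,\infty)$ of the regions of the other jobs ($\neq M$) are shifted later by $\alpha p_i$; in particular,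 if $k\ne M$, the interval $[a',b')$ of $R(k)$ containing $t$ is replaced by $[a',t)\cup[t+\alpha p_i,b'+\alpha p_i)$. Scheduling: at any time, the machine runs an admitted and not yet completed job with shortest processing time. -}

module Defs where

open import Algebra.Bundles using (CommutativeRing)
import Algebra.Construct.NaturalChoice.Max as Max
import Algebra.Construct.NaturalChoice.Min as Min
import Algebra.Properties.Semiring.Mult as Mult
open import Data.Bool.Base using (if_then_else_)
open import Data.Fin.Base using (Fin)
open import Data.Fin.Properties using (_≟_)
open import Data.List.Base using (List; []; _∷_; map; foldr; concatMap; filter; length; allFin)
open import Data.List.Relation.Unary.All using (All)
open import Data.List.Relation.Unary.Any using (Any)
open import Data.List.Relation.Unary.AllPairs using (AllPairs)
open import Data.Maybe.Base using (Maybe; just; nothing)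
open import Data.Nat.Base as ℕ using (ℕ)
open import Data.Product.Base using (_×_; ∃-syntax; Σ-syntax)
open import Data.Sum.Base using (_⊎_)
open import Data.Unit.Polymorphic.Base using (⊤)
open import Level using (Level; _⊔_; suc)
open import Relation.Binary.Bundles using (DecTotalOrder)
import Relation.Binary.Properties.DecTotalOrder as OrderProperties
open import Relation.Binary.PropositionalEquality.Core using (_≡_; _≢_)
open import Relation.Binary.Structures using (IsDecTotalOrder)
open import Relation.Nullary.Decidable using (Dec; does; yes; no)
open import Relation.Nullary.Negation using (¬_)

-- Stands in for ℝ, which the standard library lacks; classically, ℝ is one
-- such field.
record ArchimedeanOrderedField (a ℓ₁ ℓ₂ : Level) : Set (suc (a ⊔ ℓ₁ ⊔ ℓ₂)) where
  infix  4 _≤_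
  infix  8 _⁻¹
  infixl 7 _/_
  field
    commutativeRing : CommutativeRing a ℓ₁

  open CommutativeRing commutativeRing public

  field
    _≤_             : Carrier → Carrier → Set ℓ₂
    isDecTotalOrder : IsDecTotalOrder _≈_ _≤_
    +-monoˡ-≤       : ∀ z {x y} → x ≤ y → x + z ≤ y + z
    *-nonNegative   : ∀ {x y} → 0# ≤ x → 0# ≤ y → 0# ≤ x * y
    0≉1             : ¬ 0# ≈ 1#
    -- 0# ⁻¹ is unconstrained.
    _⁻¹             : Carrier → Carrier
    *-inverseʳ      : ∀ x → ¬ x ≈ 0# → x * x ⁻¹ ≈ 1#

  decTotalOrder : DecTotalOrder a ℓ₁ ℓ₂
  decTotalOrder = record { isDecTotalOrder = isDecTotalOrder }

  open DecTotalOrder decTotalOrder public using (_≤?_; totalOrder)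
  open OrderProperties decTotalOrder public using (_<_)
  open Min totalOrder public using (_⊓_)
  open Max totalOrder public using () renaming (_⊔_ to _⊔ᶠ_)

  fromℕ : ℕ → Carrier
  fromℕ n = Mult._×_ semiring n 1#

  _/_ : Carrier → Carrier → Carrier
  x / y = x * y ⁻¹

  field
    archimedean : ∀ x → ∃[ n ] x ≤ fromℕ n

module Scheduling {a ℓ₁ ℓ₂ : Level} (F : ArchimedeanOrderedField a ℓ₁ ℓ₂) where
  open ArchimedeanOrderedField F

  Time : Set a
  Time = Carrier

  record Interval : Set a where
    constructor [_,_⟩
    field
      left right : Time

  open Interval public

  infix 4 _∈ᴵ_ _∈_

  _∈ᴵ_ : Time → Interval → Set (ℓ₁ ⊔ ℓ₂)
  t ∈ᴵ J = left J ≤ t × t < right J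

  Disjoint : Interval → Interval → Set (a ⊔ ℓ₁ ⊔ ℓ₂)
  Disjoint J K = ∀ t → ¬ (t ∈ᴵ J × t ∈ᴵ K)

  -- Finite unions of half-open intervals.
  Union : Set a
  Union = List Interval

  _∈_ : Time → Union → Set (a ⊔ ℓ₁ ⊔ ℓ₂)
  t ∈ U = Any (t ∈ᴵ_) U

  -- The total length of U ∩ [ s , t ], provided U consists of pairwise
  -- disjoint intervals.
  measureWithin : Time → Time → Union → Carrier
  measureWithin s t U =
    foldr _+_ 0# (map (λ J → ((right J ⊓ t) - (left J ⊔ᶠ s)) ⊔ᶠ 0#) U)

  record Job : Set (a ⊔ ℓ₂) where
    field
      release      : Time
      processing   : Carrier
      deadline     : Time
      processing≥0 : 0# ≤ processing

  record Instance : Set (a ⊔ ℓ₂) where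
    field
      size : ℕ
      job  : Fin size → Job

    JobId : Set
    JobId = Fin size

    r p d : JobId → Carrier
    r j = Job.release (job j)
    p j = Job.processing (job j)
    d j = Job.deadline (job j)

  HasSlack : Carrier → Instance → Set ℓ₂
  HasSlack ε I = ∀ j → (1# + ε) * p j ≤ d j - r j
    where open Instance I

  -- run j is the set of times at which the machine processes j.
  record Schedule (I : Instance) : Set (a ⊔ ℓ₁ ⊔ ℓ₂) where
    open Instance I
    field
      run           : JobId → Union
      disjoint      : ∀ j → AllPairs Disjoint (run j)
      singleMachine : ∀ {i j} → i ≢ j → ∀ t → ¬ (t ∈ run i × t ∈ run j)

  module _ {I : Instance} (S : Schedule I) where
    open Instance I
    open Schedule S

    -- The amount of processing j receives within [ r j , t ].
    processed : JobId → Time → Carrier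
    processed j t = measureWithin (r j) t (run j)

    CompletedOnTime : JobId → Set ℓ₂
    CompletedOnTime j = p j ≤ processed j (d j)

    completedOnTime? : ∀ j → Dec (CompletedOnTime j)
    completedOnTime? j = p j ≤? processed j (d j)

    throughput : ℕ
    throughput = length (filter completedOnTime? (allFin size))

  IsOptimal : ∀ {I} → Schedule I → Set (a ⊔ ℓ₁ ⊔ ℓ₂)
  IsOptimal {I} S = ∀ (S′ : Schedule I) → throughput S′ ℕ.≤ throughput S

  module RegionAlgorithm (α β δ : Carrier) (I : Instance) where
    open Instance I

    record State : Set a where
      field
        admittedAt : JobId → Maybe Time
        region     : JobId → Union

    open State public

    initial : State
    initial = record { admittedAt = λ _ → nothing ; region = λ _ → [] }

    Available : State → Time → JobId → Set (a ⊔ ℓ₂)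
    Available s t i = r i ≤ t × admittedAt s i ≡ nothing × (1# + δ) * p i ≤ d i - t

    ShortestAvailable : State → Time → JobId → Set (a ⊔ ℓ₂)
    ShortestAvailable s t i = Available s t i × (∀ j → Available s t j → p i ≤ p j)

    -- nothing is the machine job.
    Owner : State → Time → Maybe JobId → Set (a ⊔ ℓ₁ ⊔ ℓ₂)
    Owner s t (just k) = t ∈ region s k
    Owner s t nothing  = ∀ k → ¬ t ∈ region s k

    -- p i < β * p k, where the machine job has infinite processing time.
    MayPreempt : JobId → Maybe JobId → Set (ℓ₁ ⊔ ℓ₂)
    MayPreempt i (just k) = p i < β * p k
    MayPreempt i nothing  = ⊤

    shift : Time → Carrier → Interval → Union
    shift t h J with right J ≤? t | t ≤? left J
    ... | yes _ | _     = J ∷ []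
    ... | no _  | yes _ = [ left J + h , right J + h ⟩ ∷ []
    ... | no _  | no _  = [ left J , t ⟩ ∷ [ t + h , right J + h ⟩ ∷ []

    admit : Time → JobId → State → State
    admit t i s = record
      { admittedAt = λ j → if does (j ≟ i) then just t else admittedAt s j
      ; region     = λ j → if does (j ≟ i)
                             then [ t , t + α * p i ⟩ ∷ []
                             else concatMap (shift t (α * p i)) (region s j)
      }

    -- Every job released and every region ending at t calls the routine, so it
    -- is called until it admits nothing.  After a job with p i > 0 is admitted
    -- all further calls at t are idle, since p i is minimal among the available
    -- jobs and β < 1; but several jobs with p i ≈ 0# (which get empty regions)
    -- may be admitted at the same time.
    data RoutineCalls (t : Time) : State → State → Set (a ⊔ ℓ₁ ⊔ ℓ₂) where
      idle   : ∀ {s k} → Owner s t k →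
               (∀ i → ShortestAvailable s t i → ¬ MayPreempt i k) →
               RoutineCalls t s s
      admits : ∀ {s s′ k i} → Owner s t k → ShortestAvailable s t i → MayPreempt i k →
               RoutineCalls t (admit t i s) s′ →
               RoutineCalls t s s′

    EndsAt : Union → Time → Set (a ⊔ ℓ₁ ⊔ ℓ₂)
    EndsAt U t = Any (λ J → right J ≈ t) U × All (λ J → right J ≤ t) U

    Event : State → Time → Set (a ⊔ ℓ₁ ⊔ ℓ₂)
    Event s t = (∃[ j ] r j ≈ t) ⊎ (∃[ k ] EndsAt (region s k) t)

    -- nothing is the time before all events.
    After : Maybe Time → Time → Set (ℓ₁ ⊔ ℓ₂)
    After nothing  t = ⊤
    After (just u) t = u < t

    NextEvent : State → Maybe Time → Time → Set (a ⊔ ℓ₁ ⊔ ℓ₂)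
    NextEvent s u t =
      After u t × Event s t × (∀ t′ → After u t′ → Event s t′ → t ≤ t′)

    -- Reachable u s: s is a possible state right after all calls up to the
    -- event time u.
    data Reachable : Maybe Time → State → Set (a ⊔ ℓ₁ ⊔ ℓ₂) where
      start : Reachable nothing initial
      step  : ∀ {u s t s′} → Reachable u s → NextEvent s u t → RoutineCalls t s s′ →
              Reachable (just t) s′

    Final : State → Set (a ⊔ ℓ₁ ⊔ ℓ₂)
    Final s = ∃[ u ] Reachable u s × (∀ t → After u t → ¬ Event s t)

    Pending : State → Schedule I → Time → JobId → Set (a ⊔ ℓ₁ ⊔ ℓ₂)
    Pending s S t j =
      (∃[ u ] admittedAt s j ≡ just u × u ≤ t) × processed S j t < p j

    record RunsShortestAdmitted (s : State) (S : Schedule I) : Set (a ⊔ ℓ₁ ⊔ ℓ₂) where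
      open Schedule S
      field
        shortest : ∀ t j → t ∈ run j →
                   Pending s S t j × (∀ i → Pending s S t i → p j ≤ p i)
        busy     : ∀ t j → Pending s S t j → ∃[ i ] t ∈ run i

    Outcome : Schedule I → Set (a ⊔ ℓ₁ ⊔ ℓ₂)
    Outcome S = Σ[ s ∈ State ] Final s × RunsShortestAdmitted s S

  Algorithm : Set (a ⊔ ℓ₁ ⊔ ℓ₂)
  Algorithm = ∀ I → Schedule I

  -- A is the region algorithm under some rule for breaking ties, both among
  -- shortest available jobs and among shortest admitted jobs.
  IsRegionAlgorithm : (α β δ : Carrier) → Algorithm → Set (a ⊔ ℓ₁ ⊔ ℓ₂)
  IsRegionAlgorithm α β δ A = ∀ I → RegionAlgorithm.Outcome α β δ I (A I)

  Competitive : (ε : Carrier) → Algorithm → (c : Carrier) → Set (a ⊔ ℓ₁ ⊔ ℓ₂)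
  Competitive ε A c =
    ∀ I → HasSlack ε I → ∀ (OPT : Schedule I) → IsOptimal OPT →
    fromℕ (throughput OPT) ≤ c * fromℕ (throughput (A I))

  -- x ≤ inf { c | Competitive ε A c }, including the case in which the set is
  -- empty and the infimum is ∞.
  CompetitiveRatioAtLeast : (ε : Carrier) → Algorithm → (x : Carrier) → Set (a ⊔ ℓ₁ ⊔ ℓ₂)
  CompetitiveRatioAtLeast ε A x = ∀ c → Competitive ε A c → x ≤ c

{-# OPTIONS --safe #-}
module Submission where

-- One unit job is released at time 0, and N jobs of length β at the times
-- δβ + iβ (i < N), where Nβ < α ≤ (N + 1)β.  The unit job is admitted first,
-- and its region [0, α) blocks every short job, as β ≮ β · 1.  A short job
-- ceases to be available at δβ + iβ + (ε − δ)β ≤ (i + 1)β ≤ Nβ < α, so it is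
-- never admitted.  The optimum runs the short jobs back to back, followed by the
-- unit job, and completes N + 1 ≥ α / β jobs instead of one.

open import Defs
open import Level using (Level)

import Algebra.Construct.NaturalChoice.Max as Max
import Algebra.Construct.NaturalChoice.Min as Min
import Algebra.Properties.AbelianGroup as AbelianGroupProperties
import Algebra.Properties.CommutativeSemigroup as CommutativeSemigroupProperties
import Algebra.Properties.Ring as RingProperties
open import Data.Empty using (⊥-elim)
open import Data.Fin.Base as Fin using (Fin; toℕ)
open import Data.Fin.Properties using (toℕ<n; toℕ-injective)
open import Data.List.Base using ([]; _∷_; filter; length; allFin)
open import Data.List.Properties using (filter-all; filter-none; length-filter; length-tabulate)
open import Data.List.Relation.Unary.All as All using (universal)
open import Data.List.Relation.Unary.All.Properties using (tabulate⁺)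
open import Data.List.Relation.Unary.AllPairs using ([]; _∷_)
open import Data.List.Relation.Unary.Any using (here; there)
open import Data.Maybe.Base using (just; nothing)
open import Data.Nat.Base as ℕ using (ℕ; zero; suc)
import Data.Nat.Properties as ℕ
open import Data.Product.Base using (_×_; _,_; proj₁; proj₂; ∃-syntax)
open import Data.Sum.Base using (inj₁; inj₂)
open import Data.Unit.Polymorphic.Base using (tt)
open import Function.Base using (_∘_; id)
open import Relation.Binary.Bundles using (DecTotalOrder)
open import Relation.Binary.Definitions using (tri<; tri≈; tri>)
import Relation.Binary.Properties.DecTotalOrder as OrderProperties
open import Relation.Binary.PropositionalEquality as ≡ using (_≡_; _≢_)
import Relation.Binary.Reasoning.PartialOrder as PosetReasoning
open import Relation.Nullary.Decidable using (yes; no)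
open import Relation.Nullary.Negation using (¬_)
open import Relation.Unary using (Decidable; Pred)

-- Applied with the unit job as `x` and the short jobs as `xs`: once every short job is known to
-- fail, whether the unit job is completed never has to be decided.
length-filter-head : ∀ {a p} {A : Set a} {P : Pred A p} (P? : Decidable P) x {xs} →
                     filter P? xs ≡ [] → length (filter P? (x ∷ xs)) ℕ.≤ 1
length-filter-head P? x {xs} eq =
  ℕ.≤-trans (filter-∷ P? x xs) (ℕ.≤-reflexive (≡.cong (suc ∘ length) eq))
  where
  filter-∷ : ∀ {a p} {A : Set a} {P : Pred A p} (P? : Decidable P) x xs →
             length (filter P? (x ∷ xs)) ℕ.≤ suc (length (filter P? xs))
  filter-∷ P? x xs with P? x
  ... | yes _ = ℕ.≤-refl
  ... | no _  = ℕ.n≤1+n _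

-- Arithmetic in an Archimedean ordered field.

module OrderedFieldProperties {a ℓ₁ ℓ₂ : Level} (F : ArchimedeanOrderedField a ℓ₁ ℓ₂) where
  open ArchimedeanOrderedField F
  open DecTotalOrder decTotalOrder public using (poset; total)
    renaming (refl to ≤-refl; trans to ≤-trans; reflexive to ≤-reflexive; antisym to ≤-antisym)
  open OrderProperties decTotalOrder public using (≰⇒>; <⇒≱)
  open RingProperties ring using ([y-z]x≈yx-zx; -‿distribʳ-*)
  open AbelianGroupProperties +-abelianGroup
    using (xyx⁻¹≈y; ⁻¹-involutive; //-rightDividesˡ; //-rightDividesʳ)
  open PosetReasoning poset

  <-≤-trans : ∀ {x y z} → x < y → y ≤ z → x < z
  <-≤-trans = ToStrict.<-≤-trans sym ≤-trans ≤-antisym (λ y≈z x≤y → ≤-trans x≤y (≤-reflexive y≈z))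
    where import Relation.Binary.Construct.NonStrictToStrict _≈_ _≤_ as ToStrict

  +-monoʳ-≤ : ∀ z {x y} → x ≤ y → z + x ≤ z + y
  +-monoʳ-≤ z {x} {y} x≤y = begin
    z + x  ≈⟨ +-comm z x ⟩
    x + z  ≤⟨ +-monoˡ-≤ z x≤y ⟩
    y + z  ≈⟨ +-comm y z ⟩
    z + y  ∎

  +-mono-≤ : ∀ {x y u v} → x ≤ y → u ≤ v → x + u ≤ y + v
  +-mono-≤ {y = y} {u = u} x≤y u≤v = ≤-trans (+-monoˡ-≤ u x≤y) (+-monoʳ-≤ y u≤v)

  +-cancelˡ-≤ : ∀ z {x y} → z + x ≤ z + y → x ≤ y
  +-cancelˡ-≤ z {x} {y} z+x≤z+y = begin
    x          ≈⟨ xyx⁻¹≈y z x ⟨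
    z + x - z  ≤⟨ +-monoˡ-≤ (- z) z+x≤z+y ⟩
    z + y - z  ≈⟨ xyx⁻¹≈y z y ⟩
    y          ∎

  x≤x+y : ∀ x {y} → 0# ≤ y → x ≤ x + y
  x≤x+y x {y} 0≤y = begin
    x       ≈⟨ +-identityʳ x ⟨
    x + 0#  ≤⟨ +-monoʳ-≤ x 0≤y ⟩
    x + y   ∎

  0≤x+y : ∀ {x y} → 0# ≤ x → 0# ≤ y → 0# ≤ x + y
  0≤x+y {x} 0≤x 0≤y = ≤-trans 0≤x (x≤x+y x 0≤y)

  x+y≤z⇒x≤z-y : ∀ {x y z} → x + y ≤ z → x ≤ z - y
  x+y≤z⇒x≤z-y {x} {y} {z} x+y≤z = begin
    x          ≈⟨ //-rightDividesʳ y x ⟨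
    x + y - y  ≤⟨ +-monoˡ-≤ (- y) x+y≤z ⟩
    z - y      ∎

  x≤z-y⇒x+y≤z : ∀ {x y z} → x ≤ z - y → x + y ≤ z
  x≤z-y⇒x+y≤z {x} {y} {z} x≤z-y = begin
    x + y      ≤⟨ +-monoˡ-≤ y x≤z-y ⟩
    z - y + y  ≈⟨ //-rightDividesˡ y z ⟩
    z          ∎

  x≤y⇒0≤y-x : ∀ {x y} → x ≤ y → 0# ≤ y - x
  x≤y⇒0≤y-x {x} x≤y = x+y≤z⇒x≤z-y (≤-trans (≤-reflexive (+-identityˡ x)) x≤y)

  x≤y⇒x-y≤0 : ∀ {x y} → x ≤ y → x - y ≤ 0#
  x≤y⇒x-y≤0 {x} {y} x≤y = ≤-trans (+-monoˡ-≤ (- y) x≤y) (≤-reflexive (-‿inverseʳ y))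

  *-monoˡ-≤ : ∀ {z} → 0# ≤ z → ∀ {x y} → x ≤ y → x * z ≤ y * z
  *-monoˡ-≤ {z} 0≤z {x} {y} x≤y = begin
    x * z       ≈⟨ +-identityˡ (x * z) ⟨
    0# + x * z  ≤⟨ x≤z-y⇒x+y≤z (≤-trans (*-nonNegative (x≤y⇒0≤y-x x≤y) 0≤z)
                                        (≤-reflexive ([y-z]x≈yx-zx z y x))) ⟩
    y * z       ∎

  -- If `1# ≤ 0#`, then `- 1#` is nonnegative, hence so is its square `1#`, and antisymmetry
  -- contradicts `0≉1`.
  0<1 : 0# < 1#
  0<1 with total 0# 1#
  ... | inj₁ 0≤1 = 0≤1 , 0≉1
  ... | inj₂ 1≤0 = ⊥-elim (0≉1 (≤-antisym 0≤1 1≤0))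
    where
    0≤-1 : 0# ≤ - 1#
    0≤-1 = ≤-trans (x≤y⇒0≤y-x 1≤0) (≤-reflexive (+-identityˡ (- 1#)))

    0≤1 : 0# ≤ 1#
    0≤1 = begin
      0#              ≤⟨ *-nonNegative 0≤-1 0≤-1 ⟩
      - 1# * - 1#     ≈⟨ -‿distribʳ-* (- 1#) 1# ⟨
      - (- 1# * 1#)   ≈⟨ -‿cong (*-identityʳ (- 1#)) ⟩
      - (- 1#)        ≈⟨ ⁻¹-involutive 1# ⟩
      1#              ∎

  -- Multiplying `x ⁻¹ ≤ 0#` by `x` would give `1# ≤ 0#`.
  0≤x⁻¹ : ∀ {x} → 0# < x → 0# ≤ x ⁻¹
  0≤x⁻¹ {x} (0≤x , 0≉x) with total 0# (x ⁻¹)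
  ... | inj₁ 0≤x⁻¹ = 0≤x⁻¹
  ... | inj₂ x⁻¹≤0 = ⊥-elim (<⇒≱ 0<1 (begin
    1#          ≈⟨ *-inverseʳ x (0≉x ∘ sym) ⟨
    x * x ⁻¹    ≈⟨ *-comm x (x ⁻¹) ⟩
    x ⁻¹ * x    ≤⟨ *-monoˡ-≤ 0≤x x⁻¹≤0 ⟩
    0# * x      ≈⟨ zeroˡ x ⟩
    0#          ∎))

  x≤y*z⇒x/z≤y : ∀ {x y z} → 0# < z → x ≤ y * z → x / z ≤ y
  x≤y*z⇒x/z≤y {x} {y} {z} 0<z x≤y*z = begin
    x * z ⁻¹        ≤⟨ *-monoˡ-≤ (0≤x⁻¹ 0<z) x≤y*z ⟩
    y * z * z ⁻¹    ≈⟨ *-assoc y z (z ⁻¹) ⟩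
    y * (z * z ⁻¹)  ≈⟨ *-congˡ (*-inverseʳ z (proj₂ 0<z ∘ sym)) ⟩
    y * 1#          ≈⟨ *-identityʳ y ⟩
    y               ∎

  x/z≤y⇒x≤y*z : ∀ {x y z} → 0# < z → x / z ≤ y → x ≤ y * z
  x/z≤y⇒x≤y*z {x} {y} {z} 0<z x/z≤y = begin
    x               ≈⟨ *-identityʳ x ⟨
    x * 1#          ≈⟨ *-congˡ (*-inverseʳ z (proj₂ 0<z ∘ sym)) ⟨
    x * (z * z ⁻¹)  ≈⟨ *-congˡ (*-comm z (z ⁻¹)) ⟩
    x * (z ⁻¹ * z)  ≈⟨ *-assoc x (z ⁻¹) z ⟨
    x / z * z       ≤⟨ *-monoˡ-≤ (proj₁ 0<z) x/z≤y ⟩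
    y * z           ∎

  -- The axiom `*-nonNegative` yields only the weak inequality. For the strict one, `x * y ≤ 0#` is
  -- divided by `y`, which gives `x ≤ 0#`.
  *-positive : ∀ {x y} → 0# < x → 0# < y → 0# < x * y
  *-positive {x} {y} 0<x 0<y = ≰⇒> λ x*y≤0 → <⇒≱ 0<x (begin
    x               ≈⟨ *-identityʳ x ⟨
    x * 1#          ≈⟨ *-congˡ (*-inverseʳ y (proj₂ 0<y ∘ sym)) ⟨
    x * (y * y ⁻¹)  ≈⟨ *-assoc x y (y ⁻¹) ⟨
    x * y / y       ≤⟨ x≤y*z⇒x/z≤y 0<y (≤-trans x*y≤0 (≤-reflexive (sym (zeroˡ y)))) ⟩
    0#              ∎)

  [1+x]*y≈y+x*y : ∀ x y → (1# + x) * y ≈ y + x * y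
  [1+x]*y≈y+x*y x y = trans (distribʳ y 1# x) (+-congʳ (*-identityˡ y))

  fromℕ-mono-≤ : ∀ {m n} → m ℕ.≤ n → fromℕ m ≤ fromℕ n
  fromℕ-mono-≤ {n = zero}  ℕ.z≤n       = ≤-refl
  fromℕ-mono-≤ {n = suc n} ℕ.z≤n       = 0≤x+y (proj₁ 0<1) (fromℕ-mono-≤ {n = n} ℕ.z≤n)
  fromℕ-mono-≤             (ℕ.s≤s m≤n) = +-monoʳ-≤ 1# (fromℕ-mono-≤ m≤n)

  0≤fromℕ : ∀ n → 0# ≤ fromℕ n
  0≤fromℕ n = fromℕ-mono-≤ {n = n} ℕ.z≤n

  -- The Archimedean property provides some multiple of `y` that is at least `x`; a downward search
  -- then stops at the first multiple that drops below `x`. It cannot pass zero, because `x` is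
  -- positive.
  lastMultipleBelow : ∀ {x y} → 0# < x → 0# < y →
                      ∃[ n ] fromℕ n * y < x × x ≤ fromℕ (suc n) * y
  lastMultipleBelow {x} {y} 0<x 0<y =
    let n , x/y≤n = archimedean (x / y) in search n (x/z≤y⇒x≤y*z 0<y x/y≤n)
    where
    search : ∀ n → x ≤ fromℕ n * y → ∃[ m ] fromℕ m * y < x × x ≤ fromℕ (suc m) * y
    search zero    x≤0 = ⊥-elim (<⇒≱ 0<x (≤-trans x≤0 (≤-reflexive (zeroˡ y))))
    search (suc n) x≤[1+n]y with x ≤? fromℕ n * y
    ... | yes x≤ny = search n x≤ny
    ... | no  x≰ny = n , ≰⇒> x≰ny , x≤[1+n]y

-- Processing received, and counting of completed jobs.

module SchedulingProperties {a ℓ₁ ℓ₂ : Level} (F : ArchimedeanOrderedField a ℓ₁ ℓ₂) where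
  open ArchimedeanOrderedField F
  open OrderedFieldProperties F
  open Scheduling F
  open PosetReasoning poset
  open Max totalOrder using (x≤x⊔y; ⊔-lub)
  open Min totalOrder using (x⊓y≤x; ⊓-glb)

  -- The window from `s` to `t` clips nothing off the interval, and the outer maximum with `0#` can
  -- only increase the value.
  measureWithin-interval : ∀ {s t} x y → s ≤ x → x + y ≤ t →
                           y ≤ measureWithin s t ([ x , x + y ⟩ ∷ [])
  measureWithin-interval {s} {t} x y s≤x x+y≤t = begin
    y                                                     ≤⟨ x+y≤z⇒x≤z-y y+[x⊔s]≤[x+y]⊓t ⟩
    ((x + y) ⊓ t) - (x ⊔ᶠ s)                              ≤⟨ x≤x⊔y _ 0# ⟩
    (((x + y) ⊓ t) - (x ⊔ᶠ s)) ⊔ᶠ 0#                      ≈⟨ +-identityʳ _ ⟨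
    measureWithin s t ([ x , x + y ⟩ ∷ [])                ∎
    where
    y+[x⊔s]≤[x+y]⊓t : y + (x ⊔ᶠ s) ≤ (x + y) ⊓ t
    y+[x⊔s]≤[x+y]⊓t = begin
      y + (x ⊔ᶠ s)  ≤⟨ +-monoʳ-≤ y (⊔-lub ≤-refl s≤x) ⟩
      y + x         ≈⟨ +-comm y x ⟩
      x + y         ≤⟨ ⊓-glb ≤-refl x+y≤t ⟩
      (x + y) ⊓ t   ∎

  -- An interval without points has `right J ≤ left J`, since otherwise `left J` would lie in it.
  -- Its clipped length is therefore cut off at zero.
  measureWithin-empty : ∀ {s t} U → (∀ u → ¬ u ∈ U) → measureWithin s t U ≤ 0#
  measureWithin-empty []      _     = ≤-refl
  measureWithin-empty {s} {t} (J ∷ U) empty = begin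
    (((right J ⊓ t) - (left J ⊔ᶠ s)) ⊔ᶠ 0#) + measureWithin s t U
      ≤⟨ +-mono-≤ (⊔-lub (x≤y⇒x-y≤0 right⊓t≤left⊔s) ≤-refl)
                  (measureWithin-empty U (λ u → empty u ∘ there)) ⟩
    0# + 0#
      ≈⟨ +-identityˡ 0# ⟩
    0#
      ∎
    where
    right≤left : right J ≤ left J
    right≤left with right J ≤? left J
    ... | yes r≤l = r≤l
    ... | no  r≰l = ⊥-elim (empty (left J) (here (≤-refl , ≰⇒> r≰l)))

    right⊓t≤left⊔s : right J ⊓ t ≤ left J ⊔ᶠ s
    right⊓t≤left⊔s = ≤-trans (x⊓y≤x (right J) t) (≤-trans right≤left (x≤x⊔y (left J) s))

  throughput≤size : ∀ {I} (S : Schedule I) → throughput S ℕ.≤ Instance.size I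
  throughput≤size {I} S =
    ℕ.≤-trans (length-filter (completedOnTime? S) (allFin size)) (ℕ.≤-reflexive (length-tabulate id))
    where open Instance I

  allCompleted⇒throughput≡size : ∀ {I} (S : Schedule I) → (∀ j → CompletedOnTime S j) →
                                 throughput S ≡ Instance.size I
  allCompleted⇒throughput≡size {I} S all = ≡.trans
    (≡.cong length (filter-all (completedOnTime? S) (universal all (allFin size))))
    (length-tabulate id)
    where open Instance I

  allCompleted⇒optimal : ∀ {I} (S : Schedule I) → (∀ j → CompletedOnTime S j) → IsOptimal S
  allCompleted⇒optimal S all S′ =
    ℕ.≤-trans (throughput≤size S′) (ℕ.≤-reflexive (≡.sym (allCompleted⇒throughput≡size S all)))

  notAdmitted⇒¬completed :
    ∀ {α β δ I s} (S : Schedule I) → RegionAlgorithm.RunsShortestAdmitted α β δ I s S →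
    ∀ j → RegionAlgorithm.State.admittedAt s j ≡ nothing →
    0# < Instance.p I j → ¬ CompletedOnTime S j
  notAdmitted⇒¬completed {α} {β} {δ} {I} S runs j notAdmitted 0<p completed =
    <⇒≱ 0<p (≤-trans completed (measureWithin-empty (run j) neverRuns))
    where
    open Schedule S
    open RegionAlgorithm α β δ I
    open RunsShortestAdmitted runs

    neverRuns : ∀ t → ¬ t ∈ run j
    neverRuns t t∈run with ((_ , admitted , _) , _) , _ ← shortest t j t∈run
                      with () ← ≡.trans (≡.sym notAdmitted) admitted

-- The hard instance and its optimal schedule.

module _ {a ℓ₁ ℓ₂ : Level} (F : ArchimedeanOrderedField a ℓ₁ ℓ₂) where
  open ArchimedeanOrderedField F
  open OrderedFieldProperties F
  open Scheduling F
  open SchedulingProperties F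
  open PosetReasoning poset
  open CommutativeSemigroupProperties +-commutativeSemigroup using (interchange)

  module LowerBound
    (ε α β δ : Carrier)
    (0<ε : 0# < ε) (ε≤1 : ε ≤ 1#) (0<β : 0# < β) (0<δ : 0# < δ) (δ<ε : δ < ε)
    (N : ℕ) (Nβ<α : fromℕ N * β < α)
    where

    private
      0≤β : 0# ≤ β
      0≤β = proj₁ 0<β

    slot : ℕ → Time
    slot k = δ * β + fromℕ k * β

    0<slot : ∀ k → 0# < slot k
    0<slot k = <-≤-trans (*-positive 0<δ 0<β) (x≤x+y (δ * β) (*-nonNegative (0≤fromℕ k) 0≤β))

    slot+β≈slot : ∀ k → slot k + β ≈ slot (suc k)
    slot+β≈slot k = begin-equality
      δ * β + fromℕ k * β + β      ≈⟨ +-assoc _ _ _ ⟩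
      δ * β + (fromℕ k * β + β)    ≈⟨ +-congˡ (+-comm _ _) ⟩
      δ * β + (β + fromℕ k * β)    ≈⟨ +-congˡ ([1+x]*y≈y+x*y (fromℕ k) β) ⟨
      δ * β + fromℕ (suc k) * β    ∎

    slot-mono-≤ : ∀ {k l} → k ℕ.≤ l → slot k ≤ slot l
    slot-mono-≤ k≤l = +-monoʳ-≤ (δ * β) (*-monoˡ-≤ 0≤β (fromℕ-mono-≤ k≤l))

    -- The order of the optimal schedule, in which the unit job comes last although it is released
    -- first.
    position : Fin (suc N) → ℕ
    position Fin.zero    = N
    position (Fin.suc i) = toℕ i

    position≤N : ∀ j → position j ℕ.≤ N
    position≤N Fin.zero    = ℕ.≤-refl
    position≤N (Fin.suc i) = ℕ.<⇒≤ (toℕ<n i)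

    position-injective : ∀ i j → position i ≡ position j → i ≡ j
    position-injective Fin.zero    Fin.zero    _  = ≡.refl
    position-injective Fin.zero    (Fin.suc j) eq = ⊥-elim (ℕ.<⇒≢ (toℕ<n j) (≡.sym eq))
    position-injective (Fin.suc i) Fin.zero    eq = ⊥-elim (ℕ.<⇒≢ (toℕ<n i) eq)
    position-injective (Fin.suc i) (Fin.suc j) eq = ≡.cong Fin.suc (toℕ-injective eq)

    begins : Fin (suc N) → Time
    begins j = slot (position j)

    processingTime : Fin (suc N) → Carrier
    processingTime Fin.zero    = 1#
    processingTime (Fin.suc _) = β

    0<processingTime : ∀ j → 0# < processingTime j
    0<processingTime Fin.zero    = 0<1
    0<processingTime (Fin.suc _) = 0<β

    released : Fin (suc N) → Time
    released Fin.zero      = 0#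
    released j@(Fin.suc _) = begins j

    released≤begins : ∀ j → released j ≤ begins j
    released≤begins Fin.zero    = proj₁ (0<slot N)
    released≤begins (Fin.suc _) = ≤-refl

    I : Instance
    I = record
      { size = suc N
      ; job  = λ j → record
        { release      = released j
        ; processing   = processingTime j
        -- Counted from the start in the optimal schedule. For a short job this start is the
        -- release, so its slack is exactly `ε`; the unit job gets enough extra time to wait for all
        -- the others.
        ; deadline     = begins j + (1# + ε) * processingTime j
        ; processing≥0 = proj₁ (0<processingTime j)
        }
      }

    open Instance I using (JobId; r; p; d)

    slack : HasSlack ε I
    slack j = x+y≤z⇒x≤z-y (begin
      (1# + ε) * p j + r j       ≤⟨ +-monoʳ-≤ _ (released≤begins j) ⟩
      (1# + ε) * p j + begins j  ≈⟨ +-comm _ _ ⟩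
      d j                        ∎)

    -- Consecutive slots of length `β` abut. The unit job has the last position, so its longer run
    -- never has to fit before another one.
    ends≤begins : ∀ i j → position i ℕ.< position j → begins i + p i ≤ begins j
    ends≤begins Fin.zero    j N<j = ⊥-elim (ℕ.<⇒≱ N<j (position≤N j))
    ends≤begins (Fin.suc i) j i<j =
      ≤-trans (≤-reflexive (slot+β≈slot (toℕ i))) (slot-mono-≤ i<j)

    OPT : Schedule I
    OPT = record
      { run           = λ j → [ begins j , begins j + p j ⟩ ∷ []
      ; disjoint      = λ _ → All.[] ∷ []
      ; singleMachine = disjointRuns
      }
      where
      disjointRuns : ∀ {i j} → i ≢ j → ∀ t →
                     ¬ (t ∈ ([ begins i , begins i + p i ⟩ ∷ []) ×
                        t ∈ ([ begins j , begins j + p j ⟩ ∷ []))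
      disjointRuns {i} {j} i≢j t (here (i≤t , t<i) , here (j≤t , t<j))
        with ℕ.<-cmp (position i) (position j)
      ... | tri< i<j _ _ = <⇒≱ t<i (≤-trans (ends≤begins i j i<j) j≤t)
      ... | tri≈ _ eq _  = i≢j (position-injective i j eq)
      ... | tri> _ _ j<i = <⇒≱ t<j (≤-trans (ends≤begins j i j<i) i≤t)

    OPT-completes : ∀ j → CompletedOnTime OPT j
    OPT-completes j = measureWithin-interval (begins j) (p j) (released≤begins j)
      (+-monoʳ-≤ (begins j) (begin
        p j             ≤⟨ x≤x+y (p j) (*-nonNegative (proj₁ 0<ε) (proj₁ (0<processingTime j))) ⟩
        p j + ε * p j   ≈⟨ [1+x]*y≈y+x*y ε (p j) ⟨
        (1# + ε) * p j  ∎))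

    -- The region algorithm on the hard instance.

    open RegionAlgorithm α β δ I

    unit : JobId
    unit = Fin.zero

    short : Fin N → JobId
    short = Fin.suc

    -- The last time at which short job number k is available is its release plus `(ε - δ) * β`,
    -- that is (k + ε)β. By `ε ≤ 1#` and k < N this is at most Nβ, which lies below `α`.
    short-expires : ∀ i {t} → (1# + δ) * β ≤ d (short i) - t → t < α
    short-expires i {t} slackLeft = begin-strict
      t                    ≤⟨ +-cancelˡ-≤ (β + δ * β) β+δβ+t≤β+δβ+[1+i]β ⟩
      fromℕ (suc k) * β    ≤⟨ *-monoˡ-≤ 0≤β (fromℕ-mono-≤ (toℕ<n i)) ⟩
      fromℕ N * β          <⟨ Nβ<α ⟩
      α                    ∎
      where
      k = toℕ i

      β+δβ+t≤β+δβ+[1+i]β : (β + δ * β) + t ≤ (β + δ * β) + fromℕ (suc k) * β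
      β+δβ+t≤β+δβ+[1+i]β = begin
        (β + δ * β) + t                      ≈⟨ +-congʳ ([1+x]*y≈y+x*y δ β) ⟨
        (1# + δ) * β + t                     ≤⟨ x≤z-y⇒x+y≤z slackLeft ⟩
        slot k + (1# + ε) * β                ≈⟨ +-congˡ ([1+x]*y≈y+x*y ε β) ⟩
        slot k + (β + ε * β)                 ≤⟨ +-monoʳ-≤ _ (+-monoʳ-≤ β (*-monoˡ-≤ 0≤β ε≤1)) ⟩
        slot k + (β + 1# * β)                ≈⟨ +-congˡ (+-congˡ (*-identityˡ β)) ⟩
        (δ * β + fromℕ k * β) + (β + β)      ≈⟨ interchange _ _ _ _ ⟩
        (δ * β + β) + (fromℕ k * β + β)      ≈⟨ +-cong (+-comm _ _) (+-comm _ _) ⟩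
        (β + δ * β) + (β + fromℕ k * β)      ≈⟨ +-congˡ ([1+x]*y≈y+x*y (fromℕ k) β) ⟨
        (β + δ * β) + fromℕ (suc k) * β      ∎

    unit-available : ∀ {t} → t ≈ 0# → Available initial t unit
    unit-available {t} t≈0 = ≤-reflexive (sym t≈0) , ≡.refl , x+y≤z⇒x≤z-y (begin
      (1# + δ) * 1# + t           ≈⟨ +-congˡ t≈0 ⟩
      (1# + δ) * 1# + 0#          ≈⟨ +-comm _ _ ⟩
      0# + (1# + δ) * 1#          ≤⟨ +-mono-≤ (proj₁ (0<slot N))
                                       (*-monoˡ-≤ (proj₁ 0<1) (+-monoʳ-≤ 1# (proj₁ δ<ε))) ⟩
      begins unit + (1# + ε) * 1# ∎)

    short-unreleased : ∀ {t} → t ≈ 0# → ∀ i → ¬ r (short i) ≤ t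
    short-unreleased t≈0 i r≤t = <⇒≱ (0<slot (toℕ i)) (≤-trans r≤t (≤-reflexive t≈0))

    -- The invariant after the first event. It fixes the whole state, so that all regions compute:
    -- the unit job owns one interval of length `α * 1#`, and every short job owns the empty union.
    -- The time is free up to `≈` because event times are only determined up to `≈`.
    data UnitOnly : State → Set (a Level.⊔ ℓ₁) where
      unitAdmitted : ∀ {u} → u ≈ 0# → UnitOnly (admit u unit initial)

    -- No further admission is possible. The unit job is no longer available, so a short job would
    -- have to preempt the unit job or the machine job; no short job owns a region.
    routine-preserves : ∀ {t s s′} → UnitOnly s → RoutineCalls t s s′ → UnitOnly s′
    routine-preserves inv (idle _ _) = inv
    routine-preserves (unitAdmitted _) (admits {i = Fin.zero} _ ((_ , () , _) , _) _ _)
    -- This is where the length `β` of the short jobs is decisive: it equals the threshold for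
    -- preempting a job of length 1, and preemption requires a strict inequality.
    routine-preserves (unitAdmitted _) (admits {k = just Fin.zero} {i = Fin.suc i} _ _ β<β*1 _) =
      ⊥-elim (<⇒≱ β<β*1 (≤-reflexive (*-identityʳ β)))
    routine-preserves (unitAdmitted _) (admits {k = just (Fin.suc _)} {i = Fin.suc i} () _ _ _)
    routine-preserves {t} (unitAdmitted {u} u≈0)
      (admits {k = nothing} {i = Fin.suc i} owner ((r≤t , _ , slackLeft) , _) _ _) =
      -- Being released and still available puts `t` between 0 and `α`, inside the unit job's
      -- region, so the machine job cannot own `t`.
      ⊥-elim (owner unit (here (u≤t , t<u+α)))
      where
      u≤t : u ≤ t
      u≤t = begin
        u              ≈⟨ u≈0 ⟩
        0#             ≤⟨ proj₁ (0<slot (toℕ i)) ⟩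
        r (short i)    ≤⟨ r≤t ⟩
        t              ∎

      t<u+α : t < u + α * 1#
      t<u+α = begin-strict
        t              <⟨ short-expires i slackLeft ⟩
        α              ≈⟨ *-identityʳ α ⟨
        α * 1#         ≈⟨ +-identityˡ (α * 1#) ⟨
        0# + α * 1#    ≈⟨ +-congʳ u≈0 ⟨
        u + α * 1#     ∎

    -- All regions are still empty, so only releases are events; none is negative, and the unit job
    -- is released at 0.
    firstEvent≈0 : ∀ {t} → NextEvent initial nothing t → t ≈ 0#
    firstEvent≈0 {t} (_ , event , least) = ≤-antisym (least 0# tt (inj₁ (unit , refl))) (0≤event event)
      where
      0≤r : ∀ j → 0# ≤ r j
      0≤r Fin.zero    = ≤-refl
      0≤r (Fin.suc i) = proj₁ (0<slot (toℕ i))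

      0≤event : Event initial t → 0# ≤ t
      0≤event (inj₁ (j , rj≈t))  = ≤-trans (0≤r j) (≤-reflexive rj≈t)
      0≤event (inj₂ (_ , () , _))

    -- At time 0 the machine job owns everything and the unit job is the only available one, so the
    -- routine can neither stay idle nor start with a short job.
    firstRoutine : ∀ {t s} → t ≈ 0# → RoutineCalls t initial s → UnitOnly s
    firstRoutine t≈0 (admits {i = Fin.zero}  _ _ _ calls) =
      routine-preserves (unitAdmitted t≈0) calls
    firstRoutine t≈0 (admits {i = Fin.suc i} _ ((r≤t , _) , _) _ _) =
      ⊥-elim (short-unreleased t≈0 i r≤t)
    firstRoutine t≈0 (idle {k = just _} () _)
    firstRoutine {t} t≈0 (idle {k = nothing} _ rejected) =
      ⊥-elim (rejected unit (unit-available t≈0 , unit-shortest) tt)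
      where
      unit-shortest : ∀ j → Available initial t j → p unit ≤ p j
      unit-shortest Fin.zero    _         = ≤-refl
      unit-shortest (Fin.suc i) (r≤t , _) = ⊥-elim (short-unreleased t≈0 i r≤t)

    reachable⇒unitOnly : ∀ {t s} → Reachable (just t) s → UnitOnly s
    reachable⇒unitOnly (step start next calls) = firstRoutine (firstEvent≈0 next) calls
    reachable⇒unitOnly (step reach@(step _ _ _) _ calls) =
      routine-preserves (reachable⇒unitOnly reach) calls

    short-notAdmitted : ∀ {s} → Final s → ∀ i → admittedAt s (short i) ≡ nothing
    short-notAdmitted (nothing , start , _) _ = ≡.refl
    short-notAdmitted (just _ , reach , _)  _ with unitAdmitted _ ← reachable⇒unitOnly reach = ≡.refl

    -- Comparison of the throughputs.

    throughput≤1 : ∀ S → Outcome S → throughput S ℕ.≤ 1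
    throughput≤1 S (s , final , runs) = length-filter-head (completedOnTime? S) unit
      (filter-none (completedOnTime? S) (tabulate⁺ λ i →
        notAdmitted⇒¬completed S runs (short i) (short-notAdmitted final i) 0<β))

    1+N≤ratio : ∀ {A c} → IsRegionAlgorithm α β δ A → Competitive ε A c → fromℕ (suc N) ≤ c
    1+N≤ratio {A} {c} isRegion competitive = bound (throughput (A I)) (throughput≤1 (A I) (isRegion I))
      (≡.subst (λ n → fromℕ n ≤ c * fromℕ (throughput (A I)))
               (allCompleted⇒throughput≡size OPT OPT-completes)
               (competitive I slack OPT (allCompleted⇒optimal OPT OPT-completes)))
      where
      bound : ∀ n → n ℕ.≤ 1 → fromℕ (suc N) ≤ c * fromℕ n → fromℕ (suc N) ≤ c
      -- The throughput is only bounded above and the sign of `c` is unknown, so the two possible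
      -- values are treated separately. Throughput 0 would force `fromℕ (suc N) ≤ 0#`.
      bound 0 _ 1+N≤c*0 = ⊥-elim (<⇒≱ 0<1 (begin
        1#             ≤⟨ x≤x+y 1# (0≤fromℕ N) ⟩
        fromℕ (suc N)  ≤⟨ 1+N≤c*0 ⟩
        c * 0#         ≈⟨ zeroʳ c ⟩
        0#             ∎))
      bound 1 _ 1+N≤c*1 = begin
        fromℕ (suc N)  ≤⟨ 1+N≤c*1 ⟩
        c * (1# + 0#)  ≈⟨ *-congˡ (+-identityʳ 1#) ⟩
        c * 1#         ≈⟨ *-identityʳ c ⟩
        c              ∎
      bound (suc (suc _)) (ℕ.s≤s ()) _

lemma9 : ∀ {a ℓ₁ ℓ₂ : Level} (F : ArchimedeanOrderedField a ℓ₁ ℓ₂) →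
  let open ArchimedeanOrderedField F
      open Scheduling F
  in ∀ (ε α β δ : Carrier) →
     0# < ε → ε ≤ 1# → 1# ≤ α → 0# < β → β < 1# → 0# < δ → δ < ε →
     ∀ (A : Algorithm) → IsRegionAlgorithm α β δ A →
     CompetitiveRatioAtLeast ε A (α / β)
lemma9 F ε α β δ 0<ε ε≤1 1≤α 0<β β<1 0<δ δ<ε A isRegion c competitive =
  -- The strict lower bound keeps the short jobs within the unit job's region; the upper bound turns
  -- `fromℕ (suc N) ≤ c` into `α / β ≤ c`.
  let N , Nβ<α , α≤[1+N]β = lastMultipleBelow (<-≤-trans 0<1 1≤α) 0<β
  in ≤-trans (x≤y*z⇒x/z≤y 0<β α≤[1+N]β)
       (LowerBound.1+N≤ratio F ε α β δ 0<ε ε≤1 0<β 0<δ δ<ε N Nβ<α isRegion competitive)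
  where
  open ArchimedeanOrderedField F
  open OrderedFieldProperties F
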